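{- (a) $\mathcal A_{23} = \mathcal A_{25} = \mathcal C_{25} = \mathcal D_{25} = \mathcal E_{25}$; (b) $\mathcal A_{12} = \mathcal B_{13} = \mathcal D_{12} = \mathcal D_{35} = \mathcal F_{13}$; (c) $\mathcal A_{35} = \mathcal F_{25}$; (d) $\mathcal B_{25} = \mathcal S$.
   Context: A zroupoid is an algebra $\langle A,\to,0\rangle$ with $\to$ binary and $0$ a constant; write $x' := x\to 0$. An implication zroupoid ($\mathcal I$-zroupoid) is a zroupoid satisfying (I) $(x\to y)\to z \approx ((z'\to x)\to(y\to z)')'$ and (I$_0$) $0''\approx 0$. Let $\mathcal S$ be the variety of $\mathcal I$-zroupoids satisfying $x''\approx x$ and $(x\to y')'\approx (y\to x')'$. Identities of Bol-Moufang type: consider the six words in variables $x,y,z$: A: $xxyz$, B: $xyxz$, C: $xyyz$, D: $xyzx$, E: $xyzy$, F: $xyzz$, and the five bracketings of a word $o_1o_2o_3o_4$: 1: $o_1\to(o_2\to(o_3\to o_4))$; 2: $o_1\to((o_2\to o_3)\to o_4)$; 3: $(o_1\to o_2)\to(o_3\to o_4)$; 4: $(o_1\to(o_2\to o_3))\to o_4$; 5: $((o_1\to o_2)\to o_3)\to o_4$. For $X\in\{A,\dots,F\}$ and $1\le i<j\le 5$, $(X_{ij})$ is the identity whose left side is word $X$ bracketed by $i$ and whose right side is word $X$ bracketed by $j$ (e.g. $(A_{23})$: $x\to((x\to y)\to z)\approx (x\to x)\to(y\to z)$). $\mathcal X_{ij}$ denotes the subvariety of $\mathcal S$ defined by $(X_{ij})$.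 -}

module Defs where

open import Level using (Level; suc)
open import Relation.Binary.PropositionalEquality using (_≡_)
open import Data.Product using (_×_)
open import Function.Bundles using (_⇔_)

-- A zroupoid ⟨A, →, 0⟩ (equality of the algebra is propositional equality)
record Zroupoid (a : Level) : Set (suc a) where
  infixr 5 _⇒_
  field
    Carrier : Set a
    _⇒_     : Carrier → Carrier → Carrier
    𝟎       : Carrier

  _′ : Carrier → Carrier
  x ′ = x ⇒ 𝟎

module _ {a : Level} (A : Zroupoid a) where
  open Zroupoid A

  IsImplicationZroupoid : Set a
  IsImplicationZroupoid =
    (∀ x y z → (x ⇒ y) ⇒ z ≡ (((z ′) ⇒ x) ⇒ ((y ⇒ z) ′)) ′)
    × ((𝟎 ′) ′ ≡ 𝟎)

  InS : Set a
  InS = IsImplicationZroupoid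
      × (∀ x → (x ′) ′ ≡ x)
      × (∀ x y → (x ⇒ (y ′)) ′ ≡ (y ⇒ (x ′)) ′)

-- The six words of Bol-Moufang type
data Word : Set where
  A B C D E F : Word

data Bracketing : Set where
  b1 b2 b3 b4 b5 : Bracketing

module _ {a : Level} (Z : Zroupoid a) where
  open Zroupoid Z

  bracket : Bracketing → Carrier → Carrier → Carrier → Carrier → Carrier
  bracket b1 o₁ o₂ o₃ o₄ = o₁ ⇒ (o₂ ⇒ (o₃ ⇒ o₄))
  bracket b2 o₁ o₂ o₃ o₄ = o₁ ⇒ ((o₂ ⇒ o₃) ⇒ o₄)
  bracket b3 o₁ o₂ o₃ o₄ = (o₁ ⇒ o₂) ⇒ (o₃ ⇒ o₄)
  bracket b4 o₁ o₂ o₃ o₄ = (o₁ ⇒ (o₂ ⇒ o₃)) ⇒ o₄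
  bracket b5 o₁ o₂ o₃ o₄ = ((o₁ ⇒ o₂) ⇒ o₃) ⇒ o₄

  eval : Word → Bracketing → Carrier → Carrier → Carrier → Carrier
  eval A b x y z = bracket b x x y z
  eval B b x y z = bracket b x y x z
  eval C b x y z = bracket b x y y z
  eval D b x y z = bracket b x y z x
  eval E b x y z = bracket b x y z y
  eval F b x y z = bracket b x y z z

  Sat : Word → Bracketing → Bracketing → Set a
  Sat X i j = ∀ x y z → eval X i x y z ≡ eval X j x y z

{-# OPTIONS --safe #-}
module Submission where

-- Put x + y = x′ ⇒ y, x · y = (x ⇒ y′)′ and 1 = 0′.  Then (I) says that + distributes
-- over ·, so membership in 𝒮 means: + and · are commutative with units 0 and 1,
-- distribute over each other, and are exchanged by the involution ′.  Absorption fails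
-- in general, but x + x · y = x + y · 0, and this weak form is enough to make both
-- operations idempotent and associative.  In these terms each class is characterised by
-- one short identity:
--   (a) 0 = 1,    (b) x + x′ = 1 + x,    (c) x + x′ = 1 + x · x′,
-- which is obtained from every identity of the class by substituting constants.

open import Defs
open import Level using (Level)
open import Algebra.Bundles using (IdempotentCommutativeMonoid)
open import Algebra.Core using (Op₁; Op₂)
import Algebra.Solver.IdempotentCommutativeMonoid as ICM-Solver
open import Data.Product using (_×_; _,_)
open import Function.Bundles using (_⇔_; mk⇔)
open import Relation.Binary.PropositionalEquality
  using (_≡_; refl; sym; trans; cong; cong₂; isEquivalence; module ≡-Reasoning)

open ≡-Reasoning

-- Two commutative operations distributing over each other, and their duality

record BidistributiveStructure {a} (X : Set a) : Set a where
  infixl 6 _+_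
  infixl 7 _·_
  field
    _+_ _·_     : Op₂ X
    0# 1#       : X
    +-comm      : ∀ x y → x + y ≡ y + x
    ·-comm      : ∀ x y → x · y ≡ y · x
    +-identityʳ : ∀ x → x + 0# ≡ x
    ·-identityʳ : ∀ x → x · 1# ≡ x
    ·-distribˡ  : ∀ x y z → x · (y + z) ≡ x · y + x · z
    +-distribˡ  : ∀ x y z → x + y · z ≡ (x + y) · (x + z)

  ·-distribʳ : ∀ x y z → (x + y) · z ≡ x · z + y · z
  ·-distribʳ x y z = begin
    (x + y) · z    ≡⟨ ·-comm _ _ ⟩
    z · (x + y)    ≡⟨ ·-distribˡ z x y ⟩
    z · x + z · y  ≡⟨ cong₂ _+_ (·-comm z x) (·-comm z y) ⟩
    x · z + y · z  ∎

-- The axioms are symmetric under exchanging `+` with `·` and `0#` with `1#`. Instantiating a module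
-- at `dual S` therefore yields the dual of each of its lemmas.
dual : ∀ {a} {X : Set a} → BidistributiveStructure X → BidistributiveStructure X
dual S = record
  { _+_ = _·_ ; _·_ = _+_ ; 0# = 1# ; 1# = 0#
  ; +-comm = ·-comm ; ·-comm = +-comm
  ; +-identityʳ = ·-identityʳ ; ·-identityʳ = +-identityʳ
  ; ·-distribˡ = +-distribˡ ; +-distribˡ = ·-distribˡ
  }
  where open BidistributiveStructure S

-- Zero absorption, idempotence and associativity

module ZeroAbsorption {a} {X : Set a} (S : BidistributiveStructure X) where
  open BidistributiveStructure S

  x+x·0≡x : ∀ x → x + x · 0# ≡ x
  x+x·0≡x x = begin
    x + x · 0#       ≡⟨ cong (_+ x · 0#) (·-identityʳ x) ⟨
    x · 1# + x · 0#  ≡⟨ ·-distribˡ x 1# 0# ⟨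
    x · (1# + 0#)    ≡⟨ cong (x ·_) (+-identityʳ 1#) ⟩
    x · 1#           ≡⟨ ·-identityʳ x ⟩
    x                ∎

module Idempotence {a} {X : Set a} (S : BidistributiveStructure X) where
  open BidistributiveStructure S

  1+1≡1 : 1# + 1# ≡ 1#
  1+1≡1 = begin
    1# + 1#         ≡⟨ ·-identityʳ _ ⟨
    (1# + 1#) · 1#  ≡⟨ ·-comm _ _ ⟩
    -- The dual law reads `x · (x + 1#) ≡ x`, taken here at `x = 1#`.
    1# · (1# + 1#)  ≡⟨ ZeroAbsorption.x+x·0≡x (dual S) 1# ⟩
    1#              ∎

  +-idem : ∀ x → x + x ≡ x
  +-idem x = begin
    x + x            ≡⟨ cong₂ _+_ (·-identityʳ x) (·-identityʳ x) ⟨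
    x · 1# + x · 1#  ≡⟨ ·-distribˡ x 1# 1# ⟨
    x · (1# + 1#)    ≡⟨ cong (x ·_) 1+1≡1 ⟩
    x · 1#           ≡⟨ ·-identityʳ x ⟩
    x                ∎

module Associativity {a} {X : Set a} (S : BidistributiveStructure X) where
  open BidistributiveStructure S
  open ZeroAbsorption S public
  open Idempotence S public

  ·-idem : ∀ x → x · x ≡ x
  ·-idem = Idempotence.+-idem (dual S)

  -- Both sides are `x · (x + y)`: expand it using `x · x ≡ x`, or read the factor `x` as `x + 0#`
  -- and apply the other distributive law.
  x+x·y≡x+y·0 : ∀ x y → x + x · y ≡ x + y · 0#
  x+x·y≡x+y·0 x y = begin
    x + x · y           ≡⟨ cong (_+ x · y) (·-idem x) ⟨
    x · x + x · y       ≡⟨ ·-distribˡ x x y ⟨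
    x · (x + y)         ≡⟨ ·-comm _ _ ⟩
    (x + y) · x         ≡⟨ cong ((x + y) ·_) (+-identityʳ x) ⟨
    (x + y) · (x + 0#)  ≡⟨ +-distribˡ x y 0# ⟨
    x + y · 0#          ∎

  -- Together with `[1+x]·0≡x·0` this makes `1# + x` and `x · 0#` determine each other, so facts can
  -- be moved between the two.
  1+x≡1+x·0 : ∀ x → 1# + x ≡ 1# + x · 0#
  1+x≡1+x·0 x = begin
    1# + x       ≡⟨ cong (1# +_) (·-identityʳ x) ⟨
    1# + x · 1#  ≡⟨ cong (1# +_) (·-comm x 1#) ⟩
    1# + 1# · x  ≡⟨ x+x·y≡x+y·0 1# x ⟩
    1# + x · 0#  ∎

  [1+x]·0≡x·0 : ∀ x → (1# + x) · 0# ≡ x · 0#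
  [1+x]·0≡x·0 x = begin
    (1# + x) · 0#      ≡⟨ ·-distribʳ 1# x 0# ⟩
    1# · 0# + x · 0#   ≡⟨ cong (_+ x · 0#) (trans (·-comm 1# 0#) (·-identityʳ 0#)) ⟩
    0# + x · 0#        ≡⟨ trans (+-comm _ _) (+-identityʳ _) ⟩
    x · 0#             ∎

  -- Associativity is not yet available, so the repeated factor is removed by a detour through
  -- `1# + x`.
  x·0·0≡x·0 : ∀ x → x · 0# · 0# ≡ x · 0#
  x·0·0≡x·0 x = begin
    x · 0# · 0#         ≡⟨ [1+x]·0≡x·0 (x · 0#) ⟨
    (1# + x · 0#) · 0#  ≡⟨ cong (_· 0#) (1+x≡1+x·0 x) ⟨
    (1# + x) · 0#       ≡⟨ [1+x]·0≡x·0 x ⟩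
    x · 0#              ∎

  x·y+x·0≡x·y : ∀ x y → x · y + x · 0# ≡ x · y
  x·y+x·0≡x·y x y = begin
    x · y + x · 0#  ≡⟨ ·-distribˡ x y 0# ⟨
    x · (y + 0#)    ≡⟨ cong (x ·_) (+-identityʳ y) ⟩
    x · y           ∎

  -- Since `(x + y) · 0#` has the same value, sum and product become indistinguishable after
  -- multiplication by `0#`. The proof multiplies weak absorption by `0#`, using that `x · y`
  -- absorbs `x · 0#`.
  [x·y]·0≡x·0+y·0 : ∀ x y → x · y · 0# ≡ x · 0# + y · 0#
  [x·y]·0≡x·0+y·0 x y = begin
    x · y · 0#                ≡⟨ cong (_· 0#) (x·y+x·0≡x·y x y) ⟨
    (x · y + x · 0#) · 0#     ≡⟨ ·-distribʳ _ _ 0# ⟩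
    x · y · 0# + x · 0# · 0#  ≡⟨ cong (x · y · 0# +_) (x·0·0≡x·0 x) ⟩
    x · y · 0# + x · 0#       ≡⟨ +-comm _ _ ⟩
    x · 0# + x · y · 0#       ≡⟨ ·-distribʳ x (x · y) 0# ⟨
    (x + x · y) · 0#          ≡⟨ cong (_· 0#) (x+x·y≡x+y·0 x y) ⟩
    (x + y · 0#) · 0#         ≡⟨ ·-distribʳ x (y · 0#) 0# ⟩
    x · 0# + y · 0# · 0#      ≡⟨ cong (x · 0# +_) (x·0·0≡x·0 y) ⟩
    x · 0# + y · 0#           ∎

  -- The case of associativity on which the general one rests. The product `y · 0# · x` absorbs
  -- `y · 0#`, and weak absorption then turns it into a sum of multiples of `0#`.
  x·[y·0]≡[x·y]·0 : ∀ x y → x · (y · 0#) ≡ x · y · 0#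
  x·[y·0]≡[x·y]·0 x y = begin
    x · (y · 0#)               ≡⟨ ·-comm _ _ ⟩
    y · 0# · x                 ≡⟨ x·y+x·0≡x·y (y · 0#) x ⟨
    y · 0# · x + y · 0# · 0#   ≡⟨ cong (y · 0# · x +_) (x·0·0≡x·0 y) ⟩
    y · 0# · x + y · 0#        ≡⟨ +-comm _ _ ⟩
    y · 0# + y · 0# · x        ≡⟨ x+x·y≡x+y·0 (y · 0#) x ⟩
    y · 0# + x · 0#            ≡⟨ +-comm _ _ ⟩
    x · 0# + y · 0#            ≡⟨ [x·y]·0≡x·0+y·0 x y ⟨
    x · y · 0#                 ∎

  -- Next to the summand `x`, a nested product containing `x` keeps only the other two factors, in a
  -- form symmetric in them. Hence differently bracketed products become comparable.
  x+z·[x·y]≡x+[y·z]·0 : ∀ x y z → x + z · (x · y) ≡ x + y · z · 0#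
  x+z·[x·y]≡x+[y·z]·0 x y z = begin
    x + z · (x · y)           ≡⟨ +-distribˡ x z (x · y) ⟩
    (x + z) · (x + x · y)     ≡⟨ cong ((x + z) ·_) (x+x·y≡x+y·0 x y) ⟩
    (x + z) · (x + y · 0#)    ≡⟨ +-distribˡ x z (y · 0#) ⟨
    x + z · (y · 0#)          ≡⟨ cong (x +_) (x·[y·0]≡[x·y]·0 z y) ⟩
    x + z · y · 0#            ≡⟨ cong (λ w → x + w · 0#) (·-comm z y) ⟩
    x + y · z · 0#            ∎

  -- By distributivity the elements w with w + p ≡ w + q are closed under ·.  For
  -- p = x · (y · z) and q = z · (x · y) they include x, y and z, hence p and q.
  ·-rotate : ∀ x y z → x · (y · z) ≡ z · (x · y)
  ·-rotate x y z = begin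
    p      ≡⟨ +-idem p ⟨
    p + p  ≡⟨ closed at-x (closed at-y at-z) ⟩
    p + q  ≡⟨ +-comm p q ⟩
    q + p  ≡⟨ closed at-z (closed at-x at-y) ⟩
    q + q  ≡⟨ +-idem q ⟩
    q      ∎
    where
    p q : X
    p = x · (y · z)
    q = z · (x · y)

    closed : ∀ {v w} → v + p ≡ v + q → w + p ≡ w + q → v · w + p ≡ v · w + q
    closed {v} {w} v≈ w≈ = begin
      v · w + p          ≡⟨ +-comm _ p ⟩
      p + v · w          ≡⟨ +-distribˡ p v w ⟩
      (p + v) · (p + w)  ≡⟨ cong₂ _·_ (swap v≈) (swap w≈) ⟩
      (q + v) · (q + w)  ≡⟨ +-distribˡ q v w ⟨
      q + v · w          ≡⟨ +-comm q _ ⟩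
      v · w + q          ∎
      where
      swap : ∀ {u} → u + p ≡ u + q → p + u ≡ q + u
      swap {u} u≈ = trans (+-comm p u) (trans u≈ (+-comm u q))

    at-x : x + p ≡ x + q
    at-x = trans (x+x·y≡x+y·0 x (y · z)) (sym (x+z·[x·y]≡x+[y·z]·0 x y z))

    at-y : y + p ≡ y + q
    at-y = begin
      y + x · (y · z)  ≡⟨ x+z·[x·y]≡x+[y·z]·0 y z x ⟩
      y + z · x · 0#   ≡⟨ cong (λ w → y + w · 0#) (·-comm z x) ⟩
      y + x · z · 0#   ≡⟨ x+z·[x·y]≡x+[y·z]·0 y x z ⟨
      y + z · (y · x)  ≡⟨ cong (λ w → y + z · w) (·-comm y x) ⟩
      y + z · (x · y)  ∎

    at-z : z + p ≡ z + q
    at-z = begin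
      z + x · (y · z)  ≡⟨ cong (λ w → z + x · w) (·-comm y z) ⟩
      z + x · (z · y)  ≡⟨ x+z·[x·y]≡x+[y·z]·0 z y x ⟩
      z + y · x · 0#   ≡⟨ cong (λ w → z + w · 0#) (·-comm y x) ⟩
      z + x · y · 0#   ≡⟨ x+x·y≡x+y·0 z (x · y) ⟨
      z + z · (x · y)  ∎

  ·-assoc : ∀ x y z → x · y · z ≡ x · (y · z)
  ·-assoc x y z = trans (·-comm (x · y) z) (sym (·-rotate x y z))

module Semilattice {a} {X : Set a} (S : BidistributiveStructure X) where
  open BidistributiveStructure S
  open Associativity S public

  -- Lets the solver reorder, regroup and merge summands, so that later proofs treat by hand only
  -- the steps in which products change.
  +-idempotentCommutativeMonoid : IdempotentCommutativeMonoid a a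
  +-idempotentCommutativeMonoid = record
    { _≈_ = _≡_ ; _∙_ = _+_ ; ε = 0#
    ; isIdempotentCommutativeMonoid = record
      { isCommutativeMonoid = record
        { isMonoid = record
          { isSemigroup = record
            { isMagma = record { isEquivalence = isEquivalence ; ∙-cong = cong₂ _+_ }
            ; assoc = Associativity.·-assoc (dual S)
            }
          ; identity = (λ x → trans (+-comm 0# x) (+-identityʳ x)) , +-identityʳ
          }
        ; comm = +-comm
        }
      ; idem = +-idem
      }
    }

-- The involution and the normal forms of the bracketings

record DeMorganStructure {a} (X : Set a) : Set a where
  infix 8 _′
  field
    bidistributive : BidistributiveStructure X
  open BidistributiveStructure bidistributive public
  field
    _′          : Op₁ X
    involutive  : ∀ x → (x ′) ′ ≡ x
    0′≡1        : 0# ′ ≡ 1#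
    deMorgan    : ∀ x y → (x + y) ′ ≡ x ′ · y ′

module DeMorgan {a} {X : Set a} (M : DeMorganStructure X) where
  open DeMorganStructure M
  open Semilattice bidistributive
  open ICM-Solver +-idempotentCommutativeMonoid using (solve; _⊕_; _⊜_; id)

  1′≡0 : 1# ′ ≡ 0#
  1′≡0 = trans (cong _′ (sym 0′≡1)) (involutive 0#)

  -- The bracketings rewritten with x ⇒ y = x′ + y.
  normal : Bracketing → X → X → X → X → X
  normal b1 o₁ o₂ o₃ o₄ = o₁ ′ + (o₂ ′ + (o₃ ′ + o₄))
  normal b2 o₁ o₂ o₃ o₄ = o₁ ′ + (o₂ · o₃ ′ + o₄)
  normal b3 o₁ o₂ o₃ o₄ = o₁ · o₂ ′ + (o₃ ′ + o₄)
  normal b4 o₁ o₂ o₃ o₄ = o₁ · (o₂ · o₃ ′) + o₄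
  normal b5 o₁ o₂ o₃ o₄ = (o₁ ′ + o₂) · o₃ ′ + o₄

  word : Word → (X → X → X → X → X) → X → X → X → X
  word A f x y z = f x x y z
  word B f x y z = f x y x z
  word C f x y z = f x y y z
  word D f x y z = f x y z x
  word E f x y z = f x y z y
  word F f x y z = f x y z z

  Holds : Word → Bracketing → Bracketing → Set a
  Holds W i j = ∀ x y z → word W (normal i) x y z ≡ word W (normal j) x y z

  x·0′≡x : ∀ x → x · 0# ′ ≡ x
  x·0′≡x x = trans (cong (x ·_) 0′≡1) (·-identityʳ x)

  -- `Trivial` identifies only the two units: any semilattice with unit satisfies it, with both
  -- operations equal and `′` the identity. The other two are forms of excluded middle; both would
  -- read `x + x ′ ≡ 1#` if `1#` absorbed every summand.
  Trivial Complemented WeaklyComplemented : Set a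
  Trivial            = 0# ≡ 1#
  Complemented       = ∀ x → x + x ′ ≡ 1# + x
  WeaklyComplemented = ∀ x → x + x ′ ≡ 1# + x · x ′

  -- Class (a): the units coincide

  -- At these letters `b2` gives `1# + y · 0#` and `b5` gives `(1# + y) · 0#`, that is, `1#` against
  -- `0#`. The letter `y` stays open because the repetitions in `A` and `E` make it `0#`, while that
  -- in `C` makes it `1#`.
  b2≡b5⇒trivial : ∀ y → y · 0# ≡ 0# →
                  normal b2 0# y 1# 0# ≡ normal b5 0# y 1# 0# → Trivial
  b2≡b5⇒trivial y y·0≡0 eq = sym (begin
    1#                       ≡⟨ 0′≡1 ⟨
    0# ′                     ≡⟨ solve 1 (λ p → p ⊜ p ⊕ (id ⊕ id)) refl (0# ′) ⟩
    0# ′ + (0# + 0#)         ≡⟨ cong (λ w → 0# ′ + (w + 0#)) y·1′≡0 ⟨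
    0# ′ + (y · 1# ′ + 0#)   ≡⟨ eq ⟩
    (0# ′ + y) · 1# ′ + 0#   ≡⟨ +-identityʳ _ ⟩
    (0# ′ + y) · 1# ′        ≡⟨ cong₂ (λ v w → (v + y) · w) 0′≡1 1′≡0 ⟩
    (1# + y) · 0#            ≡⟨ [1+x]·0≡x·0 y ⟩
    y · 0#                   ≡⟨ y·0≡0 ⟩
    0#                       ∎)
    where
    y·1′≡0 : y · 1# ′ ≡ 0#
    y·1′≡0 = trans (cong (y ·_) 1′≡0) y·0≡0

  1·0≡0 : 1# · 0# ≡ 0#
  1·0≡0 = trans (·-comm 1# 0#) (·-identityʳ 0#)

  A₂₅⇒trivial : Holds A b2 b5 → Trivial
  A₂₅⇒trivial h = b2≡b5⇒trivial 0# (·-idem 0#) (h 0# 1# 0#)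

  C₂₅⇒trivial : Holds C b2 b5 → Trivial
  C₂₅⇒trivial h = b2≡b5⇒trivial 1# 1·0≡0 (h 0# 1# 0#)

  D₂₅⇒trivial : Holds D b2 b5 → Trivial
  D₂₅⇒trivial h = b2≡b5⇒trivial 0# (·-idem 0#) (h 0# 0# 1#)

  E₂₅⇒trivial : Holds E b2 b5 → Trivial
  E₂₅⇒trivial h = b2≡b5⇒trivial 0# (·-idem 0#) (h 0# 0# 1#)

  A₂₃⇒trivial : Holds A b2 b3 → Trivial
  A₂₃⇒trivial h = sym (begin
    1#                          ≡⟨ 0′≡1 ⟨
    0# ′                        ≡⟨ solve 1 (λ p → p ⊜ p ⊕ (id ⊕ id)) refl (0# ′) ⟩
    0# ′ + (0# + 0#)            ≡⟨ cong (λ w → 0# ′ + (w + 0#)) 0·1′≡0 ⟨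
    0# ′ + (0# · 1# ′ + 0#)     ≡⟨ h 0# 1# 0# ⟩
    0# · 0# ′ + (1# ′ + 0#)     ≡⟨ cong₂ _+_ (x·0′≡x 0#) (+-identityʳ _) ⟩
    0# + 1# ′                   ≡⟨ cong (0# +_) 1′≡0 ⟩
    0# + 0#                     ≡⟨ +-idem 0# ⟩
    0#                          ∎)
    where
    0·1′≡0 : 0# · 1# ′ ≡ 0#
    0·1′≡0 = trans (cong (0# ·_) 1′≡0) (·-idem 0#)

  module _ (0≡1 : Trivial) where

    x·0≡x : ∀ x → x · 0# ≡ x
    x·0≡x x = trans (cong (x ·_) 0≡1) (·-identityʳ x)

    -- Now `0#` is a unit of `·`, so a product absorbs its factors and weak absorption reads
    -- `x + x · y ≡ x + y`.
    ·≡+ : ∀ x y → x · y ≡ x + y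
    ·≡+ x y = begin
      x · y           ≡⟨ x·y+x·0≡x·y x y ⟨
      x · y + x · 0#  ≡⟨ cong (x · y +_) (x·0≡x x) ⟩
      x · y + x       ≡⟨ +-comm _ x ⟩
      x + x · y       ≡⟨ x+x·y≡x+y·0 x y ⟩
      x + y · 0#      ≡⟨ cong (x +_) (x·0≡x y) ⟩
      x + y           ∎

    -- Once the operations coincide, both bracketings are the sum of `o₁ ′`, `o₂`, `o₃ ′` and `o₄`,
    -- whatever the word.
    trivial⇒b2≡b5 : ∀ o₁ o₂ o₃ o₄ → normal b2 o₁ o₂ o₃ o₄ ≡ normal b5 o₁ o₂ o₃ o₄
    trivial⇒b2≡b5 o₁ o₂ o₃ o₄ = begin
      o₁ ′ + (o₂ · o₃ ′ + o₄)    ≡⟨ cong (λ w → o₁ ′ + (w + o₄)) (·≡+ o₂ (o₃ ′)) ⟩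
      o₁ ′ + (o₂ + o₃ ′ + o₄)    ≡⟨ solve 4 (λ p q r s →
                                      p ⊕ ((q ⊕ r) ⊕ s) ⊜ ((p ⊕ q) ⊕ r) ⊕ s)
                                      refl (o₁ ′) o₂ (o₃ ′) o₄ ⟩
      (o₁ ′ + o₂) + o₃ ′ + o₄    ≡⟨ cong (_+ o₄) (·≡+ (o₁ ′ + o₂) (o₃ ′)) ⟨
      (o₁ ′ + o₂) · o₃ ′ + o₄    ∎

    -- Here the word matters: `b2` primes the first letter and `b3` the second, and in `A` these two
    -- are equal.
    trivial⇒A₂₃ : Holds A b2 b3
    trivial⇒A₂₃ x y z = begin
      x ′ + (x · y ′ + z)    ≡⟨ cong (λ w → x ′ + (w + z)) (·≡+ x (y ′)) ⟩
      x ′ + (x + y ′ + z)    ≡⟨ solve 4 (λ p q r s →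
                                  p ⊕ ((q ⊕ r) ⊕ s) ⊜ (q ⊕ p) ⊕ (r ⊕ s))
                                  refl (x ′) x (y ′) z ⟩
      (x + x ′) + (y ′ + z)  ≡⟨ cong (_+ (y ′ + z)) (·≡+ x (x ′)) ⟨
      x · x ′ + (y ′ + z)    ∎

  -- Class (b): complemented structures

  -- The form in which `A₁₂` and `B₁₃` give the law when `y` and `z` are set to `0#`.
  primes⇒complemented : (∀ x → x ′ + x ≡ 1# + x ′) → Complemented
  primes⇒complemented h x = begin
    x + x ′          ≡⟨ cong (_+ x ′) (involutive x) ⟨
    (x ′) ′ + x ′    ≡⟨ h (x ′) ⟩
    1# + (x ′) ′     ≡⟨ cong (1# +_) (involutive x) ⟩
    1# + x           ∎

  A₁₂⇒complemented : Holds A b1 b2 → Complemented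
  A₁₂⇒complemented h = primes⇒complemented λ x → begin
    x ′ + x                       ≡⟨ cong (x ′ +_) (trans (+-identityʳ _) (x·0′≡x x)) ⟨
    x ′ + (x · 0# ′ + 0#)         ≡⟨ h x 0# 0# ⟨
    x ′ + (x ′ + (0# ′ + 0#))     ≡⟨ solve 2 (λ p q → p ⊕ (p ⊕ (q ⊕ id)) ⊜ q ⊕ p)
                                       refl (x ′) (0# ′) ⟩
    0# ′ + x ′                    ≡⟨ cong (_+ x ′) 0′≡1 ⟩
    1# + x ′                      ∎

  B₁₃⇒complemented : Holds B b1 b3 → Complemented
  B₁₃⇒complemented h = primes⇒complemented λ x → begin
    x ′ + x                       ≡⟨ +-comm _ x ⟩
    x + x ′                       ≡⟨ cong₂ _+_ (x·0′≡x x) (+-identityʳ (x ′)) ⟨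
    x · 0# ′ + (x ′ + 0#)         ≡⟨ h x 0# 0# ⟨
    x ′ + (0# ′ + (x ′ + 0#))     ≡⟨ solve 2 (λ p q → p ⊕ (q ⊕ (p ⊕ id)) ⊜ q ⊕ p)
                                       refl (x ′) (0# ′) ⟩
    0# ′ + x ′                    ≡⟨ cong (_+ x ′) 0′≡1 ⟩
    1# + x ′                      ∎

  D₃₅⇒complemented : Holds D b3 b5 → Complemented
  D₃₅⇒complemented h x = begin
    x + x ′                       ≡⟨ +-comm x _ ⟩
    x ′ + x                       ≡⟨ cong (_+ x) (trans (x·0′≡x _) (+-identityʳ _)) ⟨
    (x ′ + 0#) · 0# ′ + x         ≡⟨ h x 0# 0# ⟨
    x · 0# ′ + (0# ′ + x)         ≡⟨ cong (_+ (0# ′ + x)) (x·0′≡x x) ⟩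
    x + (0# ′ + x)                ≡⟨ solve 2 (λ p q → p ⊕ (q ⊕ p) ⊜ q ⊕ p) refl x (0# ′) ⟩
    0# ′ + x                      ≡⟨ cong (_+ x) 0′≡1 ⟩
    1# + x                        ∎

  -- `D₁₂` and `F₁₃` need two substitutions each: one shows that adding `0# ′` hides a prime, the
  -- other that `x + x ′` absorbs `0# ′`.
  top-sums⇒complemented : (∀ x → 0# ′ + x ′ ≡ 0# ′ + x) →
                          (∀ x → 0# ′ + (x + x ′) ≡ x + x ′) → Complemented
  top-sums⇒complemented same top x = begin
    x + x ′                       ≡⟨ top x ⟨
    0# ′ + (x + x ′)              ≡⟨ solve 3 (λ t p q → t ⊕ (p ⊕ q) ⊜ p ⊕ (t ⊕ q))
                                       refl (0# ′) x (x ′) ⟩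
    x + (0# ′ + x ′)              ≡⟨ cong (x +_) (same x) ⟩
    x + (0# ′ + x)                ≡⟨ solve 2 (λ t p → p ⊕ (t ⊕ p) ⊜ t ⊕ p) refl (0# ′) x ⟩
    0# ′ + x                      ≡⟨ cong (_+ x) 0′≡1 ⟩
    1# + x                        ∎

  D₁₂⇒complemented : Holds D b1 b2 → Complemented
  D₁₂⇒complemented h = top-sums⇒complemented
    (λ x → begin
      0# ′ + x ′                      ≡⟨ solve 2 (λ t p → t ⊕ p ⊜ t ⊕ (p ⊕ (t ⊕ id)))
                                           refl (0# ′) (x ′) ⟩
      0# ′ + (x ′ + (0# ′ + 0#))      ≡⟨ h 0# x 0# ⟩
      0# ′ + (x · 0# ′ + 0#)          ≡⟨ cong (0# ′ +_) (trans (+-identityʳ _) (x·0′≡x x)) ⟩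
      0# ′ + x                        ∎)
    (λ x → begin
      0# ′ + (x + x ′)                ≡⟨ solve 3 (λ t p q → t ⊕ (p ⊕ q) ⊜ q ⊕ (t ⊕ (t ⊕ p)))
                                           refl (0# ′) x (x ′) ⟩
      x ′ + (0# ′ + (0# ′ + x))       ≡⟨ h x 0# 0# ⟩
      x ′ + (0# · 0# ′ + x)           ≡⟨ cong (λ w → x ′ + (w + x)) (x·0′≡x 0#) ⟩
      x ′ + (0# + x)                  ≡⟨ solve 2 (λ p q → q ⊕ (id ⊕ p) ⊜ p ⊕ q) refl x (x ′) ⟩
      x + x ′                         ∎)

  F₁₃⇒complemented : Holds F b1 b3 → Complemented
  F₁₃⇒complemented h = top-sums⇒complemented
    (λ x → begin
      0# ′ + x ′                      ≡⟨ solve 2 (λ t p → t ⊕ p ⊜ p ⊕ (t ⊕ (t ⊕ id)))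
                                           refl (0# ′) (x ′) ⟩
      x ′ + (0# ′ + (0# ′ + 0#))      ≡⟨ h x 0# 0# ⟩
      x · 0# ′ + (0# ′ + 0#)          ≡⟨ cong₂ _+_ (x·0′≡x x) (+-identityʳ _) ⟩
      x + 0# ′                        ≡⟨ +-comm x _ ⟩
      0# ′ + x                        ∎)
    (λ x → begin
      0# ′ + (x + x ′)                ≡⟨ solve 3 (λ t p q → t ⊕ (p ⊕ q) ⊜ t ⊕ (t ⊕ (q ⊕ p)))
                                           refl (0# ′) x (x ′) ⟩
      0# ′ + (0# ′ + (x ′ + x))       ≡⟨ h 0# 0# x ⟩
      0# · 0# ′ + (x ′ + x)           ≡⟨ cong (_+ (x ′ + x)) (x·0′≡x 0#) ⟩
      0# + (x ′ + x)                  ≡⟨ solve 2 (λ p q → id ⊕ (q ⊕ p) ⊜ p ⊕ q) refl x (x ′) ⟩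
      x + x ′                         ∎)

  module _ (complemented : Complemented) where

    -- The left side of `Complemented` is unchanged when `x` and `x ′` are exchanged, so the right
    -- side is too.
    1+x′≡1+x : ∀ x → 1# + x ′ ≡ 1# + x
    1+x′≡1+x x = begin
      1# + x ′       ≡⟨ complemented (x ′) ⟨
      x ′ + (x ′) ′  ≡⟨ cong (x ′ +_) (involutive x) ⟩
      x ′ + x        ≡⟨ +-comm _ x ⟩
      x + x ′        ≡⟨ complemented x ⟩
      1# + x         ∎

    x′·0≡x·0 : ∀ x → x ′ · 0# ≡ x · 0#
    x′·0≡x·0 x = begin
      x ′ · 0#         ≡⟨ [1+x]·0≡x·0 (x ′) ⟨
      (1# + x ′) · 0#  ≡⟨ cong (_· 0#) (1+x′≡1+x x) ⟩
      (1# + x) · 0#    ≡⟨ [1+x]·0≡x·0 x ⟩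
      x · 0#           ∎

    -- The hypothesis equates `x + x ′` with `x + 1#`, so next to the summand `x` the factor `x ′`
    -- acts like the unit.
    x+x′·y≡x+y : ∀ x y → x + x ′ · y ≡ x + y
    x+x′·y≡x+y x y = begin
      x + x ′ · y          ≡⟨ +-distribˡ x (x ′) y ⟩
      (x + x ′) · (x + y)  ≡⟨ cong (_· (x + y)) (trans (complemented x) (+-comm 1# x)) ⟩
      (x + 1#) · (x + y)   ≡⟨ +-distribˡ x 1# y ⟨
      x + 1# · y           ≡⟨ cong (x +_) (trans (·-comm 1# y) (·-identityʳ y)) ⟩
      x + y                ∎

    x′+x·y≡x′+y : ∀ x y → x ′ + x · y ≡ x ′ + y
    x′+x·y≡x′+y x y = begin
      x ′ + x · y        ≡⟨ cong (λ w → x ′ + w · y) (involutive x) ⟨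
      x ′ + (x ′) ′ · y  ≡⟨ x+x′·y≡x+y (x ′) y ⟩
      x ′ + y            ∎

    -- Next to `1#` only multiples of `0#` count, and among these neither a prime nor the difference
    -- between sum and product is visible.
    1+x·y≡1+[x′+y] : ∀ x y → 1# + x · y ≡ 1# + (x ′ + y)
    1+x·y≡1+[x′+y] x y = begin
      1# + x · y                      ≡⟨ 1+x≡1+x·0 _ ⟩
      1# + x · y · 0#                 ≡⟨ cong (1# +_) ([x·y]·0≡x·0+y·0 x y) ⟩
      1# + (x · 0# + y · 0#)          ≡⟨ cong (λ w → 1# + (w + y · 0#)) (x′·0≡x·0 x) ⟨
      1# + (x ′ · 0# + y · 0#)        ≡⟨ cong (1# +_) (·-distribʳ (x ′) y 0#) ⟨
      1# + (x ′ + y) · 0#             ≡⟨ 1+x≡1+x·0 _ ⟨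
      1# + (x ′ + y)                  ∎

    x′+x≡1+x : ∀ x → x ′ + x ≡ 1# + x
    x′+x≡1+x x = trans (+-comm _ x) (complemented x)

    complemented⇒A₁₂ : Holds A b1 b2
    complemented⇒A₁₂ x y z = begin
      x ′ + (x ′ + (y ′ + z))  ≡⟨ solve 3 (λ p q r → p ⊕ (p ⊕ (q ⊕ r)) ⊜ (p ⊕ q) ⊕ r)
                                    refl (x ′) (y ′) z ⟩
      (x ′ + y ′) + z          ≡⟨ cong (_+ z) (x′+x·y≡x′+y x (y ′)) ⟨
      (x ′ + x · y ′) + z      ≡⟨ solve 3 (λ p q r → (p ⊕ q) ⊕ r ⊜ p ⊕ (q ⊕ r))
                                    refl (x ′) (x · y ′) z ⟩
      x ′ + (x · y ′ + z)      ∎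

    complemented⇒B₁₃ : Holds B b1 b3
    complemented⇒B₁₃ x y z = begin
      x ′ + (y ′ + (x ′ + z))  ≡⟨ solve 3 (λ p q r → p ⊕ (q ⊕ (p ⊕ r)) ⊜ (p ⊕ q) ⊕ r)
                                    refl (x ′) (y ′) z ⟩
      (x ′ + y ′) + z          ≡⟨ cong (_+ z) (x′+x·y≡x′+y x (y ′)) ⟨
      (x ′ + x · y ′) + z      ≡⟨ solve 3 (λ p q r → (p ⊕ q) ⊕ r ⊜ q ⊕ (p ⊕ r))
                                    refl (x ′) (x · y ′) z ⟩
      x · y ′ + (x ′ + z)      ∎

    -- The two occurrences of `x` produce a summand `1#`, beside which `y ′ + z ′` and `y · z ′`
    -- agree.
    complemented⇒D₁₂ : Holds D b1 b2
    complemented⇒D₁₂ x y z = begin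
      x ′ + (y ′ + (z ′ + x))     ≡⟨ solve 4 (λ p q r s → p ⊕ (q ⊕ (r ⊕ s)) ⊜ (p ⊕ s) ⊕ (q ⊕ r))
                                       refl (x ′) (y ′) (z ′) x ⟩
      (x ′ + x) + (y ′ + z ′)     ≡⟨ cong (_+ (y ′ + z ′)) (x′+x≡1+x x) ⟩
      (1# + x) + (y ′ + z ′)      ≡⟨ [p+q]+r≡q+[p+r] 1# x (y ′ + z ′) ⟩
      x + (1# + (y ′ + z ′))      ≡⟨ cong (x +_) (1+x·y≡1+[x′+y] y (z ′)) ⟨
      x + (1# + y · z ′)          ≡⟨ [p+q]+r≡q+[p+r] 1# x (y · z ′) ⟨
      (1# + x) + y · z ′          ≡⟨ cong (_+ y · z ′) (x′+x≡1+x x) ⟨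
      (x ′ + x) + y · z ′         ≡⟨ solve 3 (λ p q r → (p ⊕ q) ⊕ r ⊜ p ⊕ (r ⊕ q))
                                       refl (x ′) x (y · z ′) ⟩
      x ′ + (y · z ′ + x)         ∎
      where
      [p+q]+r≡q+[p+r] : ∀ p q r → (p + q) + r ≡ q + (p + r)
      [p+q]+r≡q+[p+r] = solve 3 (λ p q r → (p ⊕ q) ⊕ r ⊜ q ⊕ (p ⊕ r)) refl

    -- Both sides reduce to `x + (z ′ + y · 0#)`; the prime that only the left side puts on `y`
    -- vanishes after multiplication by `0#`.
    complemented⇒D₃₅ : Holds D b3 b5
    complemented⇒D₃₅ x y z = begin
      x · y ′ + (z ′ + x)         ≡⟨ solve 3 (λ p q r → p ⊕ (q ⊕ r) ⊜ (r ⊕ p) ⊕ q)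
                                       refl (x · y ′) (z ′) x ⟩
      (x + x · y ′) + z ′         ≡⟨ cong (_+ z ′) (x+x·y≡x+y·0 x (y ′)) ⟩
      (x + y ′ · 0#) + z ′        ≡⟨ cong (λ w → (x + w) + z ′) (x′·0≡x·0 y) ⟩
      (x + y · 0#) + z ′          ≡⟨ solve 3 (λ p q r → (p ⊕ q) ⊕ r ⊜ p ⊕ (r ⊕ q))
                                       refl x (y · 0#) (z ′) ⟩
      x + (z ′ + y · 0#)          ≡⟨ cong (x +_) (x+x·y≡x+y·0 (z ′) y) ⟨
      x + (z ′ + z ′ · y)         ≡⟨ cong (λ w → x + (z ′ + w)) (·-comm (z ′) y) ⟩
      x + (z ′ + y · z ′)         ≡⟨ solve 3 (λ p q r → p ⊕ (q ⊕ r) ⊜ (p ⊕ q) ⊕ r)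
                                       refl x (z ′) (y · z ′) ⟩
      (x + z ′) + y · z ′         ≡⟨ cong (_+ y · z ′) (x+x′·y≡x+y x (z ′)) ⟨
      (x + x ′ · z ′) + y · z ′   ≡⟨ solve 3 (λ p q r → (p ⊕ q) ⊕ r ⊜ (q ⊕ r) ⊕ p)
                                       refl x (x ′ · z ′) (y · z ′) ⟩
      (x ′ · z ′ + y · z ′) + x   ≡⟨ cong (_+ x) (·-distribʳ (x ′) y (z ′)) ⟨
      (x ′ + y) · z ′ + x         ∎

    complemented⇒F₁₃ : Holds F b1 b3
    complemented⇒F₁₃ x y z = begin
      x ′ + (y ′ + (z ′ + z))     ≡⟨ cong (λ w → x ′ + (y ′ + w)) (x′+x≡1+x z) ⟩
      x ′ + (y ′ + (1# + z))      ≡⟨ solve 4 (λ p q t r → p ⊕ (q ⊕ (t ⊕ r)) ⊜ (t ⊕ (p ⊕ q)) ⊕ r)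
                                       refl (x ′) (y ′) 1# z ⟩
      (1# + (x ′ + y ′)) + z      ≡⟨ cong (_+ z) (1+x·y≡1+[x′+y] x (y ′)) ⟨
      (1# + x · y ′) + z          ≡⟨ solve 3 (λ t p r → (t ⊕ p) ⊕ r ⊜ p ⊕ (t ⊕ r))
                                       refl 1# (x · y ′) z ⟩
      x · y ′ + (1# + z)          ≡⟨ cong (x · y ′ +_) (x′+x≡1+x z) ⟨
      x · y ′ + (z ′ + z)         ∎

  -- Class (c): weakly complemented structures

  A₃₅⇒weaklyComplemented : Holds A b3 b5 → WeaklyComplemented
  A₃₅⇒weaklyComplemented h x = begin
    x + x ′                       ≡⟨ +-comm x _ ⟩
    x ′ + x                       ≡⟨ trans (+-identityʳ _) (x·0′≡x _) ⟨
    (x ′ + x) · 0# ′ + 0#         ≡⟨ h x 0# 0# ⟨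
    x · x ′ + (0# ′ + 0#)         ≡⟨ cong (x · x ′ +_) (trans (+-identityʳ _) 0′≡1) ⟩
    x · x ′ + 1#                  ≡⟨ +-comm _ 1# ⟩
    1# + x · x ′                  ∎

  1+[x·0+y]≡1+x·y : ∀ x y → 1# + (x · 0# + y) ≡ 1# + x · y
  1+[x·0+y]≡1+x·y x y = begin
    1# + (x · 0# + y)             ≡⟨ 1+x≡1+x·0 _ ⟩
    1# + (x · 0# + y) · 0#        ≡⟨ cong (1# +_) (·-distribʳ (x · 0#) y 0#) ⟩
    1# + (x · 0# · 0# + y · 0#)   ≡⟨ cong (λ w → 1# + (w + y · 0#)) (x·0·0≡x·0 x) ⟩
    1# + (x · 0# + y · 0#)        ≡⟨ cong (1# +_) ([x·y]·0≡x·0+y·0 x y) ⟨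
    1# + x · y · 0#               ≡⟨ 1+x≡1+x·0 _ ⟨
    1# + x · y                    ∎

  F₂₅⇒weaklyComplemented : Holds F b2 b5 → WeaklyComplemented
  F₂₅⇒weaklyComplemented h x = begin
    x + x ′                       ≡⟨ +-comm x _ ⟩
    x ′ + x                       ≡⟨ cong (_+ x) (trans (cong (_· x ′) (+-identityʳ _)) 0′·x′≡x′) ⟨
    (0# ′ + 0#) · x ′ + x         ≡⟨ h 0# 0# x ⟨
    0# ′ + (0# · x ′ + x)         ≡⟨ cong₂ (λ v w → v + (w + x)) 0′≡1 (·-comm 0# (x ′)) ⟩
    1# + (x ′ · 0# + x)           ≡⟨ 1+[x·0+y]≡1+x·y (x ′) x ⟩
    1# + x ′ · x                  ≡⟨ cong (1# +_) (·-comm (x ′) x) ⟩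
    1# + x · x ′                  ∎
    where
    0′·x′≡x′ : 0# ′ · x ′ ≡ x ′
    0′·x′≡x′ = trans (·-comm _ _) (x·0′≡x (x ′))

  module _ (weaklyComplemented : WeaklyComplemented) where

    -- The factor `x + x ′` is `1# + x · x ′`, hence a unit up to the extra summand `y · (x · x ′)`,
    -- which weak absorption simplifies.
    [x+x′]·y≡y+[x·x′]·0 : ∀ x y → (x + x ′) · y ≡ y + x · x ′ · 0#
    [x+x′]·y≡y+[x·x′]·0 x y = begin
      (x + x ′) · y           ≡⟨ cong (_· y) (weaklyComplemented x) ⟩
      (1# + x · x ′) · y      ≡⟨ ·-comm _ y ⟩
      y · (1# + x · x ′)      ≡⟨ ·-distribˡ y 1# _ ⟩
      y · 1# + y · (x · x ′)  ≡⟨ cong (_+ y · (x · x ′)) (·-identityʳ y) ⟩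
      y + y · (x · x ′)       ≡⟨ x+x·y≡x+y·0 y (x · x ′) ⟩
      y + x · x ′ · 0#        ∎

    -- Apply `′` to the hypothesis: it becomes `x ′ · x ≡ (x + x ′) · 0#`, and under `· 0#` the sum
    -- may be replaced by the product.
    [x·x′]·0≡x·x′ : ∀ x → x · x ′ · 0# ≡ x · x ′
    [x·x′]·0≡x·x′ x = begin
      x · x ′ · 0#            ≡⟨ [x·y]·0≡x·0+y·0 x (x ′) ⟩
      x · 0# + x ′ · 0#       ≡⟨ ·-distribʳ x (x ′) 0# ⟨
      (x + x ′) · 0#          ≡⟨ cong₂ _·_ [x·x′]′≡x+x′ 1′≡0 ⟨
      (x · x ′) ′ · 1# ′      ≡⟨ deMorgan (x · x ′) 1# ⟨
      (x · x ′ + 1#) ′        ≡⟨ cong _′ (trans (+-comm _ 1#) (sym (weaklyComplemented x))) ⟩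
      (x + x ′) ′             ≡⟨ deMorgan x (x ′) ⟩
      x ′ · (x ′) ′           ≡⟨ cong (x ′ ·_) (involutive x) ⟩
      x ′ · x                 ≡⟨ ·-comm _ x ⟩
      x · x ′                 ∎
      where
      [x·x′]′≡x+x′ : (x · x ′) ′ ≡ x + x ′
      [x·x′]′≡x+x′ = begin
        (x · x ′) ′           ≡⟨ cong _′ (·-comm x _) ⟩
        (x ′ · x) ′           ≡⟨ cong (λ w → (x ′ · w) ′) (involutive x) ⟨
        (x ′ · (x ′) ′) ′     ≡⟨ cong _′ (deMorgan x (x ′)) ⟨
        ((x + x ′) ′) ′       ≡⟨ involutive _ ⟩
        x + x ′               ∎

    weaklyComplemented⇒A₃₅ : Holds A b3 b5
    weaklyComplemented⇒A₃₅ x y z = begin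
      x · x ′ + (y ′ + z)         ≡⟨ solve 3 (λ p q r → p ⊕ (q ⊕ r) ⊜ (q ⊕ p) ⊕ r)
                                       refl (x · x ′) (y ′) z ⟩
      (y ′ + x · x ′) + z         ≡⟨ cong (λ w → (y ′ + w) + z) ([x·x′]·0≡x·x′ x) ⟨
      (y ′ + x · x ′ · 0#) + z    ≡⟨ cong (_+ z) ([x+x′]·y≡y+[x·x′]·0 x (y ′)) ⟨
      (x + x ′) · y ′ + z         ≡⟨ cong (λ w → w · y ′ + z) (+-comm x (x ′)) ⟩
      (x ′ + x) · y ′ + z         ∎

    -- Distributing exposes the factor `z + z ′`, whose correction term splits into `z · 0#`,
    -- absorbed by `z`, and `z ′ · 0#`.
    z+x·z′≡z+x+z′·0 : ∀ x z → z + x · z ′ ≡ z + x + z ′ · 0#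
    z+x·z′≡z+x+z′·0 x z = begin
      z + x · z ′                         ≡⟨ +-distribˡ z x (z ′) ⟩
      (z + x) · (z + z ′)                 ≡⟨ ·-comm _ _ ⟩
      (z + z ′) · (z + x)                 ≡⟨ [x+x′]·y≡y+[x·x′]·0 z (z + x) ⟩
      z + x + z · z ′ · 0#                ≡⟨ cong (z + x +_) ([x·y]·0≡x·0+y·0 z (z ′)) ⟩
      z + x + (z · 0# + z ′ · 0#)         ≡⟨ solve 4 (λ p q r s → (p ⊕ q) ⊕ (r ⊕ s) ⊜ ((p ⊕ r) ⊕ q) ⊕ s)
                                               refl z x (z · 0#) (z ′ · 0#) ⟩
      z + z · 0# + x + z ′ · 0#           ≡⟨ cong (λ w → w + x + z ′ · 0#) (x+x·0≡x z) ⟩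
      z + x + z ′ · 0#                    ∎

    -- The leftover `z ′ · 0#` from the previous lemma is harmless because `y · z ′` absorbs it.
    weaklyComplemented⇒F₂₅ : Holds F b2 b5
    weaklyComplemented⇒F₂₅ x y z = begin
      x ′ + (y · z ′ + z)                 ≡⟨ cong (λ w → x ′ + (w + z)) y·z′-absorbs ⟨
      x ′ + (y · z ′ + z ′ · 0# + z)      ≡⟨ solve 4 (λ p q r s → p ⊕ ((q ⊕ r) ⊕ s) ⊜ ((s ⊕ p) ⊕ r) ⊕ q)
                                               refl (x ′) (y · z ′) (z ′ · 0#) z ⟩
      z + x ′ + z ′ · 0# + y · z ′        ≡⟨ cong (_+ y · z ′) (z+x·z′≡z+x+z′·0 (x ′) z) ⟨
      z + x ′ · z ′ + y · z ′             ≡⟨ solve 3 (λ p q r → (p ⊕ q) ⊕ r ⊜ (q ⊕ r) ⊕ p)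
                                               refl z (x ′ · z ′) (y · z ′) ⟩
      x ′ · z ′ + y · z ′ + z             ≡⟨ cong (_+ z) (·-distribʳ (x ′) y (z ′)) ⟨
      (x ′ + y) · z ′ + z                 ∎
      where
      y·z′-absorbs : y · z ′ + z ′ · 0# ≡ y · z ′
      y·z′-absorbs = begin
        y · z ′ + z ′ · 0#    ≡⟨ cong (_+ z ′ · 0#) (·-comm y _) ⟩
        z ′ · y + z ′ · 0#    ≡⟨ x·y+x·0≡x·y (z ′) y ⟩
        z ′ · y               ≡⟨ ·-comm _ y ⟩
        y · z ′               ∎

  -- In `B` the first and third letters agree, so distributing `x ′` over `x ′ + y` gives back `x ′`
  -- by idempotence.
  B₂₅-holds : Holds B b2 b5
  B₂₅-holds x y z = begin
    x ′ + (y · x ′ + z)         ≡⟨ solve 3 (λ p q r → p ⊕ (q ⊕ r) ⊜ (p ⊕ q) ⊕ r)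
                                     refl (x ′) (y · x ′) z ⟩
    x ′ + y · x ′ + z           ≡⟨ cong (λ w → w + y · x ′ + z) (·-idem (x ′)) ⟨
    x ′ · x ′ + y · x ′ + z     ≡⟨ cong (_+ z) (·-distribʳ (x ′) y (x ′)) ⟨
    (x ′ + y) · x ′ + z         ∎

-- Algebras in 𝒮 as De Morgan structures

module Symmetric {a} (Z : Zroupoid a) (inS : InS Z) where
  open Zroupoid Z renaming (Carrier to X)

  implication : ∀ x y z → (x ⇒ y) ⇒ z ≡ (((z ′) ⇒ x) ⇒ ((y ⇒ z) ′)) ′
  implication = let ((I , _) , _) = inS in I

  ′-involutive : ∀ x → (x ′) ′ ≡ x
  ′-involutive = let (_ , inv , _) = inS in inv

  ⇒′-symmetric : ∀ x y → (x ⇒ y ′) ′ ≡ (y ⇒ x ′) ′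
  ⇒′-symmetric = let (_ , _ , symm) = inS in symm

  infixl 6 _+_
  infixl 7 _·_
  _+_ _·_ : Op₂ X
  x + y = x ′ ⇒ y
  x · y = (x ⇒ y ′) ′

  [x+y]′≡x′·y′ : ∀ x y → (x + y) ′ ≡ x ′ · y ′
  [x+y]′≡x′·y′ x y = cong (λ w → (x ′ ⇒ w) ′) (sym (′-involutive y))

  [x·y]′≡x′+y′ : ∀ x y → (x · y) ′ ≡ x ′ + y ′
  [x·y]′≡x′+y′ x y = begin
    ((x ⇒ y ′) ′) ′  ≡⟨ ′-involutive _ ⟩
    x ⇒ y ′          ≡⟨ cong (_⇒ y ′) (′-involutive x) ⟨
    (x ′) ′ ⇒ y ′    ∎

  +-comm : ∀ x y → x + y ≡ y + x
  +-comm x y = begin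
    x + y            ≡⟨ ′-involutive _ ⟨
    ((x + y) ′) ′    ≡⟨ cong _′ ([x+y]′≡x′·y′ x y) ⟩
    (x ′ · y ′) ′    ≡⟨ cong _′ (⇒′-symmetric (x ′) (y ′)) ⟩
    (y ′ · x ′) ′    ≡⟨ cong _′ ([x+y]′≡x′·y′ y x) ⟨
    ((y + x) ′) ′    ≡⟨ ′-involutive _ ⟩
    y + x            ∎

  ·-identityʳ : ∀ x → x · 𝟎 ′ ≡ x
  ·-identityʳ x = trans (cong (λ w → (x ⇒ w) ′) (′-involutive 𝟎)) (′-involutive x)

  x⇒y≡x′+y : ∀ x y → x ⇒ y ≡ x ′ + y
  x⇒y≡x′+y x y = cong (_⇒ y) (sym (′-involutive x))

  [x⇒y]′≡x·y′ : ∀ x y → (x ⇒ y) ′ ≡ x · y ′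
  [x⇒y]′≡x·y′ x y = cong (λ w → (x ⇒ w) ′) (sym (′-involutive y))

  [x·y]+z≡[x+z]·[y+z] : ∀ x y z → x · y + z ≡ (x + z) · (y + z)
  [x·y]+z≡[x+z]·[y+z] x y z = begin
    ((x ⇒ y ′) ′) ′ ⇒ z                    ≡⟨ cong (_⇒ z) (′-involutive _) ⟩
    (x ⇒ y ′) ⇒ z                          ≡⟨ implication x (y ′) z ⟩
    -- The right side of (I), taken at `x`, `y ′`, `z`, is a product of two sums by definition.
    ((z ′ ⇒ x) ⇒ (y ′ ⇒ z) ′) ′            ≡⟨⟩
    (z + x) · (y + z)                      ≡⟨ cong (_· (y + z)) (+-comm z x) ⟩
    (x + z) · (y + z)                      ∎

  +-distribˡ : ∀ x y z → x + y · z ≡ (x + y) · (x + z)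
  +-distribˡ x y z = begin
    x + y · z          ≡⟨ +-comm x _ ⟩
    y · z + x          ≡⟨ [x·y]+z≡[x+z]·[y+z] y z x ⟩
    (y + x) · (z + x)  ≡⟨ cong₂ _·_ (+-comm y x) (+-comm z x) ⟩
    (x + y) · (x + z)  ∎

  ·-distribˡ : ∀ x y z → x · (y + z) ≡ x · y + x · z
  ·-distribˡ x y z = begin
    x · (y + z)                          ≡⟨ ′-involutive _ ⟨
    ((x · (y + z)) ′) ′                  ≡⟨ cong _′ ([x·y]′≡x′+y′ x (y + z)) ⟩
    (x ′ + (y + z) ′) ′                  ≡⟨ cong (λ w → (x ′ + w) ′) ([x+y]′≡x′·y′ y z) ⟩
    (x ′ + y ′ · z ′) ′                  ≡⟨ cong _′ (+-distribˡ (x ′) (y ′) (z ′)) ⟩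
    ((x ′ + y ′) · (x ′ + z ′)) ′        ≡⟨ cong₂ (λ v w → (v · w) ′) ([x·y]′≡x′+y′ x y) ([x·y]′≡x′+y′ x z) ⟨
    ((x · y) ′ · (x · z) ′) ′            ≡⟨ cong _′ ([x+y]′≡x′·y′ (x · y) (x · z)) ⟨
    ((x · y + x · z) ′) ′                ≡⟨ ′-involutive _ ⟩
    x · y + x · z                        ∎

  deMorganStructure : DeMorganStructure X
  deMorganStructure = record
    { bidistributive = record
      { _+_ = _+_ ; _·_ = _·_ ; 0# = 𝟎 ; 1# = 𝟎 ′
      -- The symmetry law of 𝒮 unfolds to commutativity of `·`, and `x + 𝟎` unfolds to `(x ′) ′`.
      ; +-comm = +-comm ; ·-comm = ⇒′-symmetric
      ; +-identityʳ = ′-involutive ; ·-identityʳ = ·-identityʳ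
      ; ·-distribˡ = ·-distribˡ ; +-distribˡ = +-distribˡ
      }
    ; _′ = _′ ; involutive = ′-involutive ; 0′≡1 = refl ; deMorgan = [x+y]′≡x′·y′
    }

  open DeMorgan deMorganStructure public

  [x⇒y]⇒z≡x·y′+z : ∀ x y z → (x ⇒ y) ⇒ z ≡ x · y ′ + z
  [x⇒y]⇒z≡x·y′+z x y z = trans (x⇒y≡x′+y (x ⇒ y) z) (cong (_+ z) ([x⇒y]′≡x·y′ x y))

  bracket≡normal : ∀ b o₁ o₂ o₃ o₄ → bracket Z b o₁ o₂ o₃ o₄ ≡ normal b o₁ o₂ o₃ o₄
  bracket≡normal b1 o₁ o₂ o₃ o₄ = begin
    o₁ ⇒ o₂ ⇒ o₃ ⇒ o₄            ≡⟨ x⇒y≡x′+y o₁ _ ⟩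
    o₁ ′ + (o₂ ⇒ o₃ ⇒ o₄)        ≡⟨ cong (o₁ ′ +_) (x⇒y≡x′+y o₂ _) ⟩
    o₁ ′ + (o₂ ′ + (o₃ ⇒ o₄))    ≡⟨ cong (λ w → o₁ ′ + (o₂ ′ + w)) (x⇒y≡x′+y o₃ o₄) ⟩
    o₁ ′ + (o₂ ′ + (o₃ ′ + o₄))  ∎
  bracket≡normal b2 o₁ o₂ o₃ o₄ = begin
    o₁ ⇒ (o₂ ⇒ o₃) ⇒ o₄          ≡⟨ x⇒y≡x′+y o₁ _ ⟩
    o₁ ′ + ((o₂ ⇒ o₃) ⇒ o₄)      ≡⟨ cong (o₁ ′ +_) ([x⇒y]⇒z≡x·y′+z o₂ o₃ o₄) ⟩
    o₁ ′ + (o₂ · o₃ ′ + o₄)      ∎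
  bracket≡normal b3 o₁ o₂ o₃ o₄ = begin
    (o₁ ⇒ o₂) ⇒ o₃ ⇒ o₄          ≡⟨ [x⇒y]⇒z≡x·y′+z o₁ o₂ _ ⟩
    o₁ · o₂ ′ + (o₃ ⇒ o₄)        ≡⟨ cong (o₁ · o₂ ′ +_) (x⇒y≡x′+y o₃ o₄) ⟩
    o₁ · o₂ ′ + (o₃ ′ + o₄)      ∎
  bracket≡normal b4 o₁ o₂ o₃ o₄ = begin
    (o₁ ⇒ o₂ ⇒ o₃) ⇒ o₄          ≡⟨ [x⇒y]⇒z≡x·y′+z o₁ _ o₄ ⟩
    o₁ · (o₂ ⇒ o₃) ′ + o₄        ≡⟨ cong (λ w → o₁ · w + o₄) ([x⇒y]′≡x·y′ o₂ o₃) ⟩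
    o₁ · (o₂ · o₃ ′) + o₄        ∎
  bracket≡normal b5 o₁ o₂ o₃ o₄ = begin
    ((o₁ ⇒ o₂) ⇒ o₃) ⇒ o₄        ≡⟨ [x⇒y]⇒z≡x·y′+z (o₁ ⇒ o₂) o₃ o₄ ⟩
    (o₁ ⇒ o₂) · o₃ ′ + o₄        ≡⟨ cong (λ w → w · o₃ ′ + o₄) (x⇒y≡x′+y o₁ o₂) ⟩
    (o₁ ′ + o₂) · o₃ ′ + o₄      ∎

  eval≡word : ∀ W b x y z → eval Z W b x y z ≡ word W (normal b) x y z
  eval≡word A b x y z = bracket≡normal b x x y z
  eval≡word B b x y z = bracket≡normal b x y x z
  eval≡word C b x y z = bracket≡normal b x y y z
  eval≡word D b x y z = bracket≡normal b x y z x
  eval≡word E b x y z = bracket≡normal b x y z y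
  eval≡word F b x y z = bracket≡normal b x y z z

  -- Transfer to the original identities and assembly of the classes

  Sat⇒Holds : ∀ W i j → Sat Z W i j → Holds W i j
  Sat⇒Holds W i j h x y z =
    trans (sym (eval≡word W i x y z)) (trans (h x y z) (eval≡word W j x y z))

  Holds⇒Sat : ∀ W i j → Holds W i j → Sat Z W i j
  Holds⇒Sat W i j h x y z =
    trans (eval≡word W i x y z) (trans (h x y z) (sym (eval≡word W j x y z)))

  Sat-⇔ : ∀ {p} (P : Set p) V i j W k l →
          (Holds V i j → P) → (P → Holds V i j) →
          (Holds W k l → P) → (P → Holds W k l) →
          Sat Z V i j ⇔ Sat Z W k l
  Sat-⇔ P V i j W k l V⇒P P⇒V W⇒P P⇒W = mk⇔
    (λ h → Holds⇒Sat W k l (P⇒W (V⇒P (Sat⇒Holds V i j h))))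
    (λ h → Holds⇒Sat V i j (P⇒V (W⇒P (Sat⇒Holds W k l h))))

  A₂₃⇔ : ∀ W → (Holds W b2 b5 → Trivial) → (Trivial → Holds W b2 b5) →
         Sat Z A b2 b3 ⇔ Sat Z W b2 b5
  A₂₃⇔ W = Sat-⇔ Trivial A b2 b3 W b2 b5 A₂₃⇒trivial trivial⇒A₂₃

  A₁₂⇔ : ∀ W i j → (Holds W i j → Complemented) → (Complemented → Holds W i j) →
         Sat Z A b1 b2 ⇔ Sat Z W i j
  A₁₂⇔ W i j = Sat-⇔ Complemented A b1 b2 W i j A₁₂⇒complemented complemented⇒A₁₂

theorem4p1 : ∀ {a : Level} (Z : Zroupoid a) → InS Z →
    ((Sat Z A b2 b3 ⇔ Sat Z A b2 b5) × (Sat Z A b2 b3 ⇔ Sat Z C b2 b5)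
    × (Sat Z A b2 b3 ⇔ Sat Z D b2 b5) × (Sat Z A b2 b3 ⇔ Sat Z E b2 b5))
    × ((Sat Z A b1 b2 ⇔ Sat Z B b1 b3) × (Sat Z A b1 b2 ⇔ Sat Z D b1 b2)
    × (Sat Z A b1 b2 ⇔ Sat Z D b3 b5) × (Sat Z A b1 b2 ⇔ Sat Z F b1 b3))
    × (Sat Z A b3 b5 ⇔ Sat Z F b2 b5)
    × Sat Z B b2 b5
theorem4p1 Z inS =
    ( A₂₃⇔ A A₂₅⇒trivial (λ t x y z → trivial⇒b2≡b5 t x x y z)
    , A₂₃⇔ C C₂₅⇒trivial (λ t x y z → trivial⇒b2≡b5 t x y y z)
    , A₂₃⇔ D D₂₅⇒trivial (λ t x y z → trivial⇒b2≡b5 t x y z x)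
    , A₂₃⇔ E E₂₅⇒trivial (λ t x y z → trivial⇒b2≡b5 t x y z y) )
  , ( A₁₂⇔ B b1 b3 B₁₃⇒complemented complemented⇒B₁₃
    , A₁₂⇔ D b1 b2 D₁₂⇒complemented complemented⇒D₁₂
    , A₁₂⇔ D b3 b5 D₃₅⇒complemented complemented⇒D₃₅
    , A₁₂⇔ F b1 b3 F₁₃⇒complemented complemented⇒F₁₃ )
  , Sat-⇔ WeaklyComplemented A b3 b5 F b2 b5
      A₃₅⇒weaklyComplemented weaklyComplemented⇒A₃₅
      F₂₅⇒weaklyComplemented weaklyComplemented⇒F₂₅
  , Holds⇒Sat B b2 b5 B₂₅-holds
  where open Symmetric Z inS
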